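{- Let $m \ge 1$ be an integer and let $K_{m,m}$ be the balanced complete bipartite graph on $2m$ vertices. Then $\mathrm{s}[K_{m,m}^\circ, 2] = 2m-1$ and $\mathrm{s}_+[K_{m,m}^\circ, 2] = m$.
   Context: Graphs are finite and directed. $K_{m,m}$ has vertex set $V=L\cup R$ with $L=\{l_1,\dots,l_m\}$, $R=\{r_1,\dots,r_m\}$ disjoint, and its arcs are all $(l_i,r_j)$ and all $(r_j,l_i)$, $1\le i,j\le m$. For a loopless graph $D$, $D^\circ$ is obtained from $D$ by adding a loop $(v,v)$ on every vertex. Let $n$ be the number of vertices and index coordinates of $[2]^n=\{0,1\}^n$ by the vertices. For $f=(f_v)_{v\in V}:[2]^n\to[2]^n$, the interaction graph $G(f)$ has vertex set $V$ and an arc $(u,v)$ if and only if there exist $x,y\in[2]^n$ differing only in coordinate $u$ with $f_v(x)\ne f_v(y)$. $\mathrm{F}[H,2]$ is the set of all $f:[2]^n\to[2]^n$ with $G(f)=H$, and $\mathrm{F}_+[H,2]$ is the subset of those $f$ that are monotone, i.e. $x\le y$ coordinatewise implies $f(x)\le f(y)$ coordinatewise. With $d_{\mathrm H}$ the Hamming distance, $\mathrm{s}(f)=\min_{x\in[2]^n}(n-d_{\mathrm H}(x,f(x)))$, $\mathrm{s}[H,2]=\max_{f\in\mathrm{F}[H,2]}\mathrm{s}(f)$ and $\mathrm{s}_+[H,2]=\max_{f\in\mathrm{F}_+[H,2]}\mathrm{s}(f)$. -}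

module Defs where

open import Level using (0ℓ)
open import Data.Bool using (Bool; true; false; _≤_; _≟_)
open import Data.Fin using (Fin; _↑ˡ_; _↑ʳ_)
open import Data.Nat as ℕ using (ℕ; zero; suc; _+_; _∸_; _⊓_)
import Data.Nat.Properties as ℕₚ
open import Data.Product using (_×_; _,_; ∃; ∃₂; uncurry)
open import Data.Sum using (_⊎_; inj₁; inj₂)
open import Data.Vec using (Vec; []; _∷_; lookup; count; zip)
open import Data.Vec.Relation.Binary.Pointwise.Inductive using (Pointwise)
open import Function using (_∘_)
open import Relation.Binary using (Rel; _⇔_)
open import Relation.Binary.PropositionalEquality using (_≡_; _≢_; refl; sym; trans)
open import Relation.Nullary using (¬?)
open import Relation.Unary using (Pred; _∩_)

Digraph : ℕ → Set₁
Digraph n = Rel (Fin n) 0ℓ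

-- The vertices are l i = i ↑ˡ m and r j = m ↑ʳ j.
data K (m : ℕ) : Digraph (m + m) where
  l→r : ∀ i j → K m (i ↑ˡ m) (m ↑ʳ j)
  r→l : ∀ i j → K m (m ↑ʳ j) (i ↑ˡ m)

infix 8 _°

_° : ∀ {n} → Digraph n → Digraph n
(D °) u v = D u v ⊎ u ≡ v

-- {0,1}ⁿ, with 0 = false and 1 = true.
-- Vectors rather than functions Fin n → Bool: without function
-- extensionality, maps between function types need not respect
-- pointwise equality.
Config : ℕ → Set
Config n = Vec Bool n

Map : ℕ → Set
Map n = Config n → Config n

DifferOnlyAt : ∀ {n} → Fin n → Rel (Config n) 0ℓ
DifferOnlyAt u x y =
  lookup x u ≢ lookup y u × (∀ w → w ≢ u → lookup x w ≡ lookup y w)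

G : ∀ {n} → Map n → Digraph n
G f u v = ∃₂ λ x y → DifferOnlyAt u x y × lookup (f x) v ≢ lookup (f y) v

Monotone : ∀ {n} → Pred (Map n) 0ℓ
Monotone f = ∀ x y → Pointwise _≤_ x y → Pointwise _≤_ (f x) (f y)

-- Equality of graphs on the same vertex set is equality of arc sets.
F[_,2] : ∀ {n} → Digraph n → Pred (Map n) 0ℓ
F[ H ,2] f = G f ⇔ H

F₊[_,2] : ∀ {n} → Digraph n → Pred (Map n) 0ℓ
F₊[ H ,2] = F[ H ,2] ∩ Monotone

hamming : ∀ {n} → Config n → Config n → ℕ
hamming x y = count (λ ab → ¬? (uncurry _≟_ ab)) (zip x y)

minimum : ∀ {n} → (Config n → ℕ) → ℕ
minimum {zero}  g = g []
minimum {suc n} g = minimum (g ∘ (false ∷_)) ⊓ minimum (g ∘ (true ∷_))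

minimum-≤ : ∀ {n} (g : Config n → ℕ) x → minimum g ℕ.≤ g x
minimum-≤ g []          = ℕₚ.≤-refl
minimum-≤ g (false ∷ x) = ℕₚ.≤-trans (ℕₚ.m⊓n≤m _ _) (minimum-≤ (g ∘ (false ∷_)) x)
minimum-≤ g (true ∷ x)  = ℕₚ.≤-trans (ℕₚ.m⊓n≤n _ _) (minimum-≤ (g ∘ (true ∷_)) x)

minimum-attained : ∀ {n} (g : Config n → ℕ) → ∃ λ x → g x ≡ minimum g
minimum-attained {zero}  g = [] , refl
minimum-attained {suc n} g
  with ℕₚ.⊓-sel (minimum (g ∘ (false ∷_))) (minimum (g ∘ (true ∷_)))
... | inj₁ p = let x , q = minimum-attained (g ∘ (false ∷_)) in false ∷ x , trans q (sym p)
... | inj₂ p = let x , q = minimum-attained (g ∘ (true ∷_)) in true ∷ x , trans q (sym p)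

s : ∀ {n} → Map n → ℕ
s {n} f = minimum λ x → n ∸ hamming x (f x)

-- k is the maximum of g over the elements satisfying P; in particular
-- P is inhabited.
IsMaximum : ∀ {A : Set} → Pred A 0ℓ → (A → ℕ) → ℕ → Set
IsMaximum P g k = (∃ λ a → P a × g a ≡ k) × (∀ a → P a → g a ℕ.≤ k)

s[_,2]≡_ : ∀ {n} → Digraph n → ℕ → Set
s[ H ,2]≡ k = IsMaximum F[ H ,2] s k

s₊[_,2]≡_ : ∀ {n} → Digraph n → ℕ → Set
s₊[ H ,2]≡ k = IsMaximum F₊[ H ,2] s k

{-# OPTIONS --safe #-}

-- Upper bounds. If (u , v) is an arc of G f with u ≢ v, some state z has
-- f_v(z) ≢ z_v, for otherwise f_v would not depend on u; so s f < n. If moreover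
-- f is monotone, let p take opposite values on L and R. Then v is unstable at p
-- or at its complement: say z_v = 0 (the other case is dual) and p_v = 0 (else
-- replace p by its complement); as p is 1 on the neighbours of v, z ∧ p agrees
-- with z on all inputs of f_v, so 1 = f_v(z) = f_v(z ∧ p) ≤ f_v(p). Hence one of
-- these two states has at least m of the 2m vertices unstable.
--
-- Lower bounds. For every family C, the map which sets v to 0 when its
-- in-neighbours spell the pattern C v, and keeps v otherwise, has interaction
-- graph D ° as soon as every vertex of D has an in-neighbour. The patterns e_i
-- for l_i and ¬ e_j for r_j leave at most one vertex unstable; the zero patterns
-- give a monotone map whose unstable vertices all lie on one side.
module Submission where

open import Data.Bool
  using (Bool; true; false; not; _∧_; _∨_; b≤b; _≟_; if_then_else_)
import Data.Bool as Bool
open import Data.Bool.Properties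
  using (¬-not; not-¬; not-injective)
import Data.Bool.Properties as Boolₚ
open import Data.Fin using (Fin; zero; suc; _↑ˡ_; _↑ʳ_; splitAt)
import Data.Fin.Properties as Finₚ
open import Data.Nat using (ℕ; zero; suc; _≤_; _+_; _*_; _∸_; z≤n; s≤s)
import Data.Nat.Properties as ℕₚ
open import Data.Product using (_×_; _,_; ∃; proj₁; proj₂)
open import Data.Sum using (_⊎_; inj₁; inj₂; [_,_]′)
open import Data.Vec
  using ([]; _∷_; lookup; map; zip; zipWith; tabulate; _[_]%=_)
open import Data.Vec.Properties
  using (lookup∘updateAt; lookup∘updateAt′; lookup-zipWith; lookup-map;
         lookup∘tabulate; count≤n)
open import Data.Vec.Relation.Binary.Pointwise.Extensional
  using (ext; extensional⇒inductive)
open import Data.Vec.Relation.Binary.Pointwise.Inductive using (Pointwise)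
import Data.Vec.Relation.Binary.Pointwise.Inductive as Pointwise
open import Function using (_∘_; const)
open import Relation.Binary using (Decidable; Irreflexive)
open import Relation.Binary.PropositionalEquality
  using (_≡_; _≢_; refl; sym; trans; cong; subst; module ≡-Reasoning)
open import Relation.Nullary using (¬_; ¬?; Dec; yes; no; does; contradiction)
open import Relation.Nullary.Decidable
  using (map′; decidable-stable; dec-true; dec-false; _→-dec_)
open import Defs

private
  variable
    m n k : ℕ

-- Hamming distance and stability

hamming≤n : (x y : Config n) → hamming x y ≤ n
hamming≤n x y = count≤n _ (zip x y)

hamming≡0 : (x y : Config n) → (∀ v → lookup x v ≡ lookup y v) → hamming x y ≡ 0
hamming≡0 []      []      x≡y = refl
hamming≡0 (a ∷ x) (b ∷ y) x≡y with a ≟ b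
... | yes _   = hamming≡0 x y (x≡y ∘ suc)
... | no  a≢b = contradiction (x≡y zero) a≢b

hamming≥1 : (x y : Config n) (v : Fin n) → lookup x v ≢ lookup y v → 1 ≤ hamming x y
hamming≥1 (a ∷ x) (b ∷ y) v       x≢y with a ≟ b
hamming≥1 (a ∷ x) (b ∷ y) _       x≢y | no _    = s≤s z≤n
hamming≥1 (a ∷ x) (b ∷ y) zero    x≢y | yes a≡b = contradiction a≡b x≢y
hamming≥1 (a ∷ x) (b ∷ y) (suc v) x≢y | yes _   = hamming≥1 x y v x≢y

hamming≤1 : (x y : Config n) →
            (∀ {u v} → lookup x u ≢ lookup y u → lookup x v ≢ lookup y v → u ≡ v) →
            hamming x y ≤ 1
hamming≤1 []      []      unique = z≤n
hamming≤1 (a ∷ x) (b ∷ y) unique with a ≟ b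
... | yes _   = hamming≤1 x y λ p q → Finₚ.suc-injective (unique p q)
... | no  a≢b = s≤s (ℕₚ.≤-reflexive (hamming≡0 x y λ v →
                  decidable-stable (_ ≟ _) λ x≢y → Finₚ.0≢1+n (unique {zero} {suc v} a≢b x≢y)))

hamming≤ˡ : ∀ m (x y : Config (m + n)) →
            (∀ j → lookup x (m ↑ʳ j) ≡ lookup y (m ↑ʳ j)) → hamming x y ≤ m
hamming≤ˡ zero    x       y       x≡y = ℕₚ.≤-reflexive (hamming≡0 x y x≡y)
hamming≤ˡ (suc m) (a ∷ x) (b ∷ y) x≡y with a ≟ b
... | yes _ = ℕₚ.m≤n⇒m≤1+n (hamming≤ˡ m x y x≡y)
... | no  _ = s≤s (hamming≤ˡ m x y x≡y)

hamming≤ʳ : ∀ m (x y : Config (m + n)) →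
            (∀ i → lookup x (i ↑ˡ n) ≡ lookup y (i ↑ˡ n)) → hamming x y ≤ n
hamming≤ʳ zero    x       y       x≡y = hamming≤n x y
hamming≤ʳ (suc m) (a ∷ x) (b ∷ y) x≡y with a ≟ b
... | yes _   = hamming≤ʳ m x y (x≡y ∘ suc)
... | no  a≢b = contradiction (x≡y zero) a≢b

-- Every coordinate is counted in at least one of the two distances. This serves to show that one of
-- two states has at least half of the vertices unstable.
n≤hamming+hamming : (x y x′ y′ : Config n) →
                    (∀ v → lookup x v ≢ lookup y v ⊎ lookup x′ v ≢ lookup y′ v) →
                    n ≤ hamming x y + hamming x′ y′
n≤hamming+hamming []      []      []        []        cover = z≤n
n≤hamming+hamming (a ∷ x) (b ∷ y) (a′ ∷ x′) (b′ ∷ y′) cover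
  with n≤hamming+hamming x y x′ y′ (cover ∘ suc) | a ≟ b | a′ ≟ b′
... | ih | no _    | no _      = s≤s (ℕₚ.≤-trans ih (ℕₚ.+-monoʳ-≤ (hamming x y) (ℕₚ.n≤1+n _)))
... | ih | no _    | yes _     = s≤s ih
... | ih | yes _   | no _      = ℕₚ.≤-trans (s≤s ih) (ℕₚ.≤-reflexive (sym (ℕₚ.+-suc (hamming x y) _)))
... | _  | yes a≡b | yes a′≡b′ =
  contradiction (cover zero) [ contradiction a≡b , contradiction a′≡b′ ]′

s≤n∸k : (f : Map n) (x : Config n) → k ≤ hamming x (f x) → s f ≤ n ∸ k
s≤n∸k {n} f x k≤h = ℕₚ.≤-trans (minimum-≤ _ x) (ℕₚ.∸-monoʳ-≤ n k≤h)

n∸k≤s : (f : Map n) → (∀ x → hamming x (f x) ≤ k) → n ∸ k ≤ s f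
n∸k≤s {n} f h≤k =
  let x , eq = minimum-attained (λ x → n ∸ hamming x (f x))
  in ℕₚ.≤-trans (ℕₚ.∸-monoʳ-≤ n (h≤k x)) (ℕₚ.≤-reflexive eq)

-- Interaction graphs

Unstable : Map n → Config n → Fin n → Set
Unstable f x v = lookup x v ≢ lookup (f x) v

-- Changes `x` into `y` one coordinate at a time, tail before head. Working with one Boolean-valued
-- `g` lets the induction absorb the fixed head into `g ∘ (a ∷_)`.
agree-on-inputs⇒≡ : (g : Config n → Bool) (x y : Config n) →
                    (∀ u → lookup x u ≢ lookup y u →
                     ∀ {a b} → DifferOnlyAt u a b → g a ≡ g b) →
                    g x ≡ g y
agree-on-inputs⇒≡ g []      []      _     = refl
agree-on-inputs⇒≡ g (a ∷ x) (b ∷ y) indep =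
  trans (agree-on-inputs⇒≡ (g ∘ (a ∷_)) x y λ u x≢y (d , same) →
           indep (suc u) x≢y (d , λ { zero _ → refl ; (suc w) w≢u → same w (w≢u ∘ cong suc) }))
        head-step
  where
  head-step : g (a ∷ y) ≡ g (b ∷ y)
  head-step with a ≟ b
  ... | yes refl = refl
  ... | no  a≢b  = indep zero a≢b
    (a≢b , λ { zero 0≢0 → contradiction refl 0≢0 ; (suc _) _ → refl })

-- A coordinate where `x` and `y` differ has no arc to `v`. Decidable equality of Booleans turns
-- this absence into invariance under changing that coordinate.
G-local : (f : Map n) (v : Fin n) (x y : Config n) →
          (∀ u → G f u v → lookup x u ≡ lookup y u) → lookup (f x) v ≡ lookup (f y) v
G-local f v x y agree = agree-on-inputs⇒≡ (λ z → lookup (f z) v) x y λ u x≢y {a} {b} d →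
  decidable-stable (_ ≟ _) λ fa≢fb → x≢y (agree u (a , b , d , fa≢fb))

-- The two states witnessing the arc agree at `v` but their images do not, so one image misses the
-- common value.
arc⇒unstable : (f : Map n) {u v : Fin n} → G f u v → u ≢ v → ∃ λ z → Unstable f z v
arc⇒unstable f {v = v} (a , b , (_ , same) , fa≢fb) u≢v with lookup a v ≟ lookup (f a) v
... | no  a≢fa = a , a≢fa
... | yes a≡fa = b , λ b≡fb →
  fa≢fb (trans (sym a≡fa) (trans (same v (u≢v ∘ sym)) b≡fb))

-- Monotone maps at a state and its complement

module _ {D : Digraph n} (f : Map n) (mono : Monotone f)
         (G⊆D° : ∀ {u v} → G f u v → (D °) u v) where

  unstable-transfer : ∀ {v} (p z : Config n) → (∀ {u} → D u v → lookup p u ≢ lookup p v) →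
                      Unstable f z v → lookup z v ≡ lookup p v → Unstable f p v
  unstable-transfer {v} p z anti z≢fz zv≡pv with lookup p v in pv
  ... | false = λ 0≡fp → contradiction
    (trans (sym fw≡1) (Boolₚ.≤-antisym (subst (lookup (f w) v Bool.≤_) (sym 0≡fp) fw≤fp)
                                       (Boolₚ.≤-minimum _)))
    λ ()
    where
    -- The meet lies below `p`, yet equals `z` on every input of `v`: `p` is 1 on the
    -- `D`-in-neighbours, and `z` and `p` are both 0 at `v`, which covers the loop.
    w = zipWith _∧_ z p

    w≤p : Pointwise Bool._≤_ w p
    w≤p = extensional⇒inductive (ext λ u →
      subst (Bool._≤ _) (sym (lookup-zipWith _∧_ u z p)) (∧≤ʳ (lookup z u) (lookup p u)))
      where
      ∧≤ʳ : ∀ a b → a ∧ b Bool.≤ b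
      ∧≤ʳ false b = Boolₚ.≤-minimum b
      ∧≤ʳ true  b = b≤b

    fw≤fp : lookup (f w) v Bool.≤ lookup (f p) v
    fw≤fp = Pointwise.lookup (mono w p w≤p) v

    w≡z : ∀ u → G f u v → lookup w u ≡ lookup z u
    w≡z u arc with G⊆D° arc
    ... | inj₁ Duv  = trans (lookup-zipWith _∧_ u z p)
      (trans (cong (lookup z u ∧_) (¬-not (anti Duv))) (Boolₚ.∧-identityʳ _))
    ... | inj₂ refl = trans (lookup-zipWith _∧_ u z p)
      (trans (cong (_∧ _) zv≡pv) (sym zv≡pv))

    fw≡1 : lookup (f w) v ≡ true
    fw≡1 = trans (G-local f v w z w≡z)
      (¬-not λ fz≡0 → z≢fz (trans zv≡pv (sym fz≡0)))
  ... | true = λ 1≡fp → contradiction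
    (trans (sym fw≡0) (Boolₚ.≤-antisym (Boolₚ.≤-maximum _)
                                       (subst (Bool._≤ lookup (f w) v) (sym 1≡fp) fp≤fw)))
    λ ()
    where
    -- Dually, `p` is now 0 on the `D`-in-neighbours and 1 at `v`, so the join lies above `p` and
    -- keeps the inputs of `z`.
    w = zipWith _∨_ z p

    p≤w : Pointwise Bool._≤_ p w
    p≤w = extensional⇒inductive (ext λ u →
      subst (_ Bool.≤_) (sym (lookup-zipWith _∨_ u z p)) (≤∨ʳ (lookup z u) (lookup p u)))
      where
      ≤∨ʳ : ∀ a b → b Bool.≤ a ∨ b
      ≤∨ʳ false b = b≤b
      ≤∨ʳ true  b = Boolₚ.≤-maximum b

    fp≤fw : lookup (f p) v Bool.≤ lookup (f w) v
    fp≤fw = Pointwise.lookup (mono p w p≤w) v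

    w≡z : ∀ u → G f u v → lookup w u ≡ lookup z u
    w≡z u arc with G⊆D° arc
    ... | inj₁ Duv  = trans (lookup-zipWith _∨_ u z p)
      (trans (cong (lookup z u ∨_) (¬-not (anti Duv))) (Boolₚ.∨-identityʳ _))
    ... | inj₂ refl = trans (lookup-zipWith _∨_ u z p)
      (trans (cong (_∨ _) zv≡pv) (sym zv≡pv))

    fw≡0 : lookup (f w) v ≡ false
    fw≡0 = trans (G-local f v w z w≡z)
      (¬-not λ fz≡1 → z≢fz (trans zv≡pv (sym fz≡1)))

  unstable-at-p-or-complement :
    ∀ {u v} (p : Config n) → (∀ {w} → D w v → lookup p w ≢ lookup p v) →
    G f u v → u ≢ v → Unstable f p v ⊎ Unstable f (map not p) v
  unstable-at-p-or-complement {v = v} p anti arc u≢v with arc⇒unstable f arc u≢v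
  ... | z , z≢fz with lookup z v ≟ lookup p v
  ... | yes zv≡pv = inj₁ (unstable-transfer p z anti z≢fz zv≡pv)
  ... | no  zv≢pv = inj₂ (unstable-transfer (map not p) z anti-not z≢fz
                      (trans (¬-not zv≢pv) (sym (lookup-map v not p))))
    where
    anti-not : ∀ {w} → D w v → lookup (map not p) w ≢ lookup (map not p) v
    anti-not {w} Dwv eq = anti Dwv (not-injective
      (trans (sym (lookup-map w not p)) (trans eq (lookup-map v not p))))

-- Maps vetoing a pattern of in-neighbours

module Veto {D : Digraph n} (D? : Decidable D) (irrefl : Irreflexive _≡_ D)
            (C : Fin n → Fin n → Bool) where

  Vetoed : Config n → Fin n → Set
  Vetoed x v = ∀ u → D u v → lookup x u ≡ C v u

  vetoed? : ∀ x v → Dec (Vetoed x v)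
  vetoed? x v = Finₚ.all? λ u → D? u v →-dec (lookup x u ≟ C v u)

  veto : Map n
  veto x = tabulate λ v → lookup x v ∧ not (does (vetoed? x v))

  lookup-veto : ∀ x v → lookup (veto x) v ≡ lookup x v ∧ not (does (vetoed? x v))
  lookup-veto x = lookup∘tabulate _

  veto-vetoed : ∀ x v → Vetoed x v → lookup (veto x) v ≡ false
  veto-vetoed x v vx = trans (lookup-veto x v)
    (trans (cong (λ b → lookup x v ∧ not b) (dec-true (vetoed? x v) vx)) (Boolₚ.∧-zeroʳ _))

  veto-kept : ∀ x v → ¬ Vetoed x v → lookup (veto x) v ≡ lookup x v
  veto-kept x v ¬vx = trans (lookup-veto x v)
    (trans (cong (λ b → lookup x v ∧ not b) (dec-false (vetoed? x v) ¬vx)) (Boolₚ.∧-identityʳ _))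

  veto-≤ : ∀ x v → lookup (veto x) v Bool.≤ lookup x v
  veto-≤ x v with vetoed? x v
  ... | yes vx = subst (Bool._≤ _) (sym (veto-vetoed x v vx)) (Boolₚ.≤-minimum _)
  ... | no ¬vx = Boolₚ.≤-reflexive (veto-kept x v ¬vx)

  unstable⇒true : ∀ x v → Unstable veto x v → lookup x v ≡ true
  unstable⇒true x v x≢fx = ¬-not λ x≡0 →
    x≢fx (trans x≡0 (sym (Boolₚ.≤-antisym (subst (lookup (veto x) v Bool.≤_) x≡0 (veto-≤ x v)) (Boolₚ.≤-minimum _))))

  unstable⇒vetoed : ∀ x v → Unstable veto x v → Vetoed x v
  unstable⇒vetoed x v x≢fx =
    decidable-stable (vetoed? x v) λ ¬vx → x≢fx (sym (veto-kept x v ¬vx))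

  veto-local : ∀ x y v → lookup x v ≡ lookup y v →
               (∀ u → D u v → lookup x u ≡ lookup y u) → lookup (veto x) v ≡ lookup (veto y) v
  veto-local x y v xv≡yv agree with vetoed? x v
  ... | yes vx = trans (veto-vetoed x v vx) (sym (veto-vetoed y v λ u Duv →
                   trans (sym (agree u Duv)) (vx u Duv)))
  ... | no ¬vx = trans (veto-kept x v ¬vx) (trans xv≡yv (sym (veto-kept y v λ vy →
                   ¬vx λ u Duv → trans (agree u Duv) (vy u Duv))))

  G-veto⊆ : ∀ {u v} → G veto u v → (D °) u v
  G-veto⊆ {u} {v} (a , b , (_ , same) , fa≢fb) with D? u v | u Finₚ.≟ v
  ... | yes Duv | _       = inj₁ Duv
  ... | no _    | yes u≡v = inj₂ u≡v
  ... | no ¬Duv | no u≢v  = contradiction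
    (veto-local a b v (same v (u≢v ∘ sym)) λ w Dwv → same w λ { refl → ¬Duv Dwv }) fa≢fb

  %=-differ : ∀ (x : Config n) u → DifferOnlyAt u x (x [ u ]%= not)
  %=-differ x u = (λ eq → not-¬ refl (trans eq (lookup∘updateAt u x)))
                , λ w w≢u → sym (lookup∘updateAt′ w u w≢u x)

  -- A state where `v` is both vetoed and 1, so that the veto is visible; the default `true`
  -- supplies the value at `v` itself.
  trigger : Fin n → Config n
  trigger v = tabulate λ u → if does (D? u v) then C v u else true

  trigger-vetoed : ∀ v → Vetoed (trigger v) v
  trigger-vetoed v u Duv = trans (lookup∘tabulate _ u)
    (cong (if_then C v u else true) (dec-true (D? u v) Duv))

  trigger-self : ∀ v → lookup (trigger v) v ≡ true
  trigger-self v = trans (lookup∘tabulate _ v)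
    (cong (if_then C v v else true) (dec-false (D? v v) (irrefl refl)))

  -- One wrong in-neighbour breaks the pattern. Fixing `x` only at `u` makes this apply again after
  -- `v` is flipped too.
  near-trigger-kept : ∀ {u v} → D u v → ∀ x → lookup x u ≡ lookup (trigger v [ u ]%= not) u →
                      lookup (veto x) v ≡ lookup x v
  near-trigger-kept {u} {v} Duv x eq = veto-kept x v λ vx →
    not-¬ (sym (trigger-vetoed v u Duv))
          (trans (sym (vx u Duv)) (trans eq (lookup∘updateAt u (trigger v))))

  D⊆G-veto : ∀ {u v} → D u v → G veto u v
  D⊆G-veto {u} {v} Duv = trigger v , b , %=-differ (trigger v) u , λ eq →
    contradiction (trans (sym (veto-vetoed (trigger v) v (trigger-vetoed v))) (trans eq fb≡1)) λ ()
    where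
    b = trigger v [ u ]%= not

    fb≡1 : lookup (veto b) v ≡ true
    fb≡1 = trans (near-trigger-kept Duv b refl)
      (trans (lookup∘updateAt′ v u (λ v≡u → irrefl (sym v≡u) Duv) (trigger v)) (trigger-self v))

  -- With `u` off the pattern, `v` copies its own value, so flipping `v` changes its image.
  loop∈G-veto : ∀ {u v} → D u v → G veto v v
  loop∈G-veto {u} {v} Duv = b , c , differ , λ eq → proj₁ differ
    (trans (sym (near-trigger-kept Duv b refl))
      (trans eq (near-trigger-kept Duv c (sym (proj₂ differ u (λ u≡v → irrefl u≡v Duv))))))
    where
    b = trigger v [ u ]%= not
    c = b [ v ]%= not
    differ = %=-differ b v

  veto∈F : (∀ v → ∃ λ u → D u v) → F[ D ° ,2] veto
  veto∈F pred = G-veto⊆ , λ where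
    (inj₁ Duv)          → D⊆G-veto Duv
    {v} (inj₂ refl)     → loop∈G-veto (proj₂ (pred v))

  -- In-neighbours that are all 0 in `y` are all 0 in any `x` below it, so a veto at `y` holds at
  -- `x`. Without a veto at `y`, the image of `x` is at most `x`, hence at most `y`, which is kept.
  veto-monotone : (∀ v u → C v u ≡ false) → Monotone veto
  veto-monotone C≡0 x y x≤y = Pointwise.tabulate⁺ λ v →
    subst₂≤ (lookup-veto x v) (lookup-veto y v) (step v)
    where
    subst₂≤ : ∀ {a a′ b b′} → a ≡ a′ → b ≡ b′ → a Bool.≤ b → a′ Bool.≤ b′
    subst₂≤ refl refl p = p

    step : ∀ v → lookup (veto x) v Bool.≤ lookup (veto y) v
    step v with vetoed? y v
    ... | yes vy = Boolₚ.≤-reflexive (trans (veto-vetoed x v vx) (sym (veto-vetoed y v vy)))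
      where
      vx : Vetoed x v
      vx u Duv = trans
        (Boolₚ.≤-antisym (subst (_ Bool.≤_) (trans (vy u Duv) (C≡0 v u)) (Pointwise.lookup x≤y u))
                         (Boolₚ.≤-minimum _))
        (sym (C≡0 v u))
    ... | no ¬vy = Boolₚ.≤-trans (veto-≤ x v)
      (subst (_ Bool.≤_) (sym (veto-kept y v ¬vy)) (Pointwise.lookup x≤y v))

-- The graph K m

-- A view of the vertices, as `_↑ˡ_` and `_↑ʳ_` are functions and cannot be matched on.
data Side (m : ℕ) : Fin (m + m) → Set where
  l : ∀ i → Side m (i ↑ˡ m)
  r : ∀ j → Side m (m ↑ʳ j)

side : ∀ m v → Side m v
side m v with splitAt m v in eq
... | inj₁ i = subst (Side m) (Finₚ.splitAt⁻¹-↑ˡ eq) (l i)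
... | inj₂ j = subst (Side m) (Finₚ.splitAt⁻¹-↑ʳ eq) (r j)

-- Arcs of `K m` are exactly the pairs of distinct colours, which makes `K m` decidable. Read as a
-- state, the colouring is also the `p` of the monotone upper bound.
colour : ∀ m → Fin (m + m) → Bool
colour m v = [ const false , const true ]′ (splitAt m v)

colour-l : ∀ m i → colour m (i ↑ˡ m) ≡ false
colour-l m i = cong [ const false , const true ]′ (Finₚ.splitAt-↑ˡ m i m)

colour-r : ∀ m j → colour m (m ↑ʳ j) ≡ true
colour-r m j = cong [ const false , const true ]′ (Finₚ.splitAt-↑ʳ m m j)

K⇒bichromatic : ∀ {u v} → K m u v → colour m u ≢ colour m v
K⇒bichromatic {m} (l→r i j) eq = contradiction (trans (sym (colour-l m i)) (trans eq (colour-r m j))) λ ()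
K⇒bichromatic {m} (r→l i j) eq = contradiction (trans (sym (colour-r m j)) (trans eq (colour-l m i))) λ ()

bichromatic⇒K : ∀ {u v} → colour m u ≢ colour m v → K m u v
bichromatic⇒K {m} {u} {v} u≢v with side m u | side m v
... | l i | r j = l→r i j
... | r j | l i = r→l i j
... | l i | l k = contradiction (trans (colour-l m i) (sym (colour-l m k))) u≢v
... | r j | r k = contradiction (trans (colour-r m j) (sym (colour-r m k))) u≢v

K? : Decidable (K m)
K? {m} u v = map′ bichromatic⇒K K⇒bichromatic (¬? (colour m u ≟ colour m v))

K-irrefl : Irreflexive _≡_ (K m)
K-irrefl refl arc = K⇒bichromatic arc refl

K-pred : ∀ m → 1 ≤ m → ∀ v → ∃ λ u → K m u v
K-pred m@(suc _) _ v with side m v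
... | l i = m ↑ʳ zero , r→l i zero
... | r j = zero ↑ˡ m , l→r zero j

-- Upper bounds

s≤n∸1 : ∀ m → 1 ≤ m → (f : Map (m + m)) → F[ K m ° ,2] f → s f ≤ m + m ∸ 1
s≤n∸1 m@(suc _) 1≤m f (_ , K°⊆G) =
  let u , arc = K-pred m 1≤m zero
      z , z≢fz = arc⇒unstable f (K°⊆G (inj₁ arc)) (λ u≡v → K-irrefl u≡v arc)
  in s≤n∸k f z (hamming≥1 z (f z) zero z≢fz)

half≤one-of : ∀ m a b → m + m ≤ a + b → m ≤ a ⊎ m ≤ b
half≤one-of m a b 2m≤a+b with m ℕₚ.≤? a
... | yes m≤a = inj₁ m≤a
... | no  m≰a = inj₂ (ℕₚ.+-cancelˡ-≤ m m b (ℕₚ.≤-trans 2m≤a+b (ℕₚ.+-monoˡ-≤ b (ℕₚ.≰⇒≥ m≰a))))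

s₊≤m : ∀ m → 1 ≤ m → (f : Map (m + m)) → F₊[ K m ° ,2] f → s f ≤ m
s₊≤m m 1≤m f ((G⊆K° , K°⊆G) , mono) = subst (s f ≤_) (ℕₚ.m+n∸n≡m m m)
  ([ s≤n∸k f p , s≤n∸k f (map not p) ]′
    (half≤one-of m _ _ (n≤hamming+hamming p (f p) (map not p) (f (map not p)) cover)))
  where
  p = tabulate (colour m)

  anti : ∀ {u v} → K m u v → lookup p u ≢ lookup p v
  anti {u} {v} arc eq = K⇒bichromatic arc
    (trans (sym (lookup∘tabulate _ u)) (trans eq (lookup∘tabulate _ v)))

  cover : ∀ v → Unstable f p v ⊎ Unstable f (map not p) v
  cover v = let u , arc = K-pred m 1≤m v in
    unstable-at-p-or-complement f mono G⊆K° p anti (K°⊆G (inj₁ arc)) (λ u≡v → K-irrefl u≡v arc)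

-- Lower bounds from unit and zero patterns

unitPatterns : ∀ m → Fin (m + m) → Fin (m + m) → Bool
unitPatterns m v u with splitAt m v | splitAt m u
... | inj₁ i | inj₂ j = does (i Finₚ.≟ j)
... | inj₂ j | inj₁ i = not (does (i Finₚ.≟ j))
... | _      | _      = false

unitPatterns-lr : ∀ m i j → unitPatterns m (i ↑ˡ m) (m ↑ʳ j) ≡ does (i Finₚ.≟ j)
unitPatterns-lr m i j rewrite Finₚ.splitAt-↑ˡ m i m | Finₚ.splitAt-↑ʳ m m j = refl

unitPatterns-rl : ∀ m i j → unitPatterns m (m ↑ʳ j) (i ↑ˡ m) ≡ not (does (i Finₚ.≟ j))
unitPatterns-rl m i j rewrite Finₚ.splitAt-↑ˡ m i m | Finₚ.splitAt-↑ʳ m m j = refl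

does-true : ∀ {A : Set} (a? : Dec A) → does a? ≡ true → A
does-true (yes a) _ = a

module _ (m : ℕ) where
  open Veto (K? {m}) K-irrefl (unitPatterns m)

  -- Both vertices would have value 1. The pattern of the left one then forces `i ≡ j`, and that of
  -- the right one forces `i ≢ j`.
  unit-unstable-one-side : ∀ x i j → Unstable veto x (i ↑ˡ m) → ¬ Unstable veto x (m ↑ʳ j)
  unit-unstable-one-side x i j p q = not-¬ does≡true (begin
    true                                  ≡⟨ unstable⇒true x _ p ⟨
    lookup x (i ↑ˡ m)                     ≡⟨ unstable⇒vetoed x _ q (i ↑ˡ m) (l→r i j) ⟩
    unitPatterns m (m ↑ʳ j) (i ↑ˡ m)      ≡⟨ unitPatterns-rl m i j ⟩
    not (does (i Finₚ.≟ j))               ∎)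
    where
    open ≡-Reasoning

    does≡true : true ≡ does (i Finₚ.≟ j)
    does≡true = begin
      true                                ≡⟨ unstable⇒true x _ q ⟨
      lookup x (m ↑ʳ j)                   ≡⟨ unstable⇒vetoed x _ p (m ↑ʳ j) (r→l i j) ⟩
      unitPatterns m (i ↑ˡ m) (m ↑ʳ j)    ≡⟨ unitPatterns-lr m i j ⟩
      does (i Finₚ.≟ j)                   ∎

  unit-unstable-unique : ∀ x {u v} → Unstable veto x u → Unstable veto x v → u ≡ v
  unit-unstable-unique x {u} {v} p q with side m u | side m v
  ... | l i | r j = contradiction q (unit-unstable-one-side x i j p)
  ... | r j | l i = contradiction p (unit-unstable-one-side x i j q)
  -- The right side spells both e_i and e_k; comparing them at the right vertex `i` gives `k ≡ i`.
  ... | l i | l k = cong (_↑ˡ m) (sym (does-true (k Finₚ.≟ i) (begin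
    does (k Finₚ.≟ i)                     ≡⟨ unitPatterns-lr m k i ⟨
    unitPatterns m (k ↑ˡ m) (m ↑ʳ i)      ≡⟨ unstable⇒vetoed x _ q (m ↑ʳ i) (r→l k i) ⟨
    lookup x (m ↑ʳ i)                     ≡⟨ unstable⇒vetoed x _ p (m ↑ʳ i) (r→l i i) ⟩
    unitPatterns m (i ↑ˡ m) (m ↑ʳ i)      ≡⟨ unitPatterns-lr m i i ⟩
    does (i Finₚ.≟ i)                     ≡⟨ dec-true (i Finₚ.≟ i) refl ⟩
    true                                  ∎)))
    where open ≡-Reasoning
  -- The complemented unit patterns are compared at their zero, the left vertex `j`.
  ... | r j | r k = cong (m ↑ʳ_) (does-true (j Finₚ.≟ k) (not-injective (begin
    not (does (j Finₚ.≟ k))               ≡⟨ unitPatterns-rl m j k ⟨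
    unitPatterns m (m ↑ʳ k) (j ↑ˡ m)      ≡⟨ unstable⇒vetoed x _ q (j ↑ˡ m) (l→r j k) ⟨
    lookup x (j ↑ˡ m)                     ≡⟨ unstable⇒vetoed x _ p (j ↑ˡ m) (l→r j j) ⟩
    unitPatterns m (m ↑ʳ j) (j ↑ˡ m)      ≡⟨ unitPatterns-rl m j j ⟩
    not (does (j Finₚ.≟ j))               ≡⟨ cong not (dec-true (j Finₚ.≟ j) refl) ⟩
    false                                 ∎)))
    where open ≡-Reasoning

  unit-s : m + m ∸ 1 ≤ s veto
  unit-s = n∸k≤s veto λ x → hamming≤1 x (veto x) (unit-unstable-unique x)

module _ (m : ℕ) where
  open Veto (K? {m}) K-irrefl (λ _ _ → false)

  -- Unstable vertices have value 1, so if the left side is all 0 it is stable. Otherwise no right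
  -- vertex is vetoed, and the right side is stable.
  zero-unstable≤m : ∀ x → hamming x (veto x) ≤ m
  zero-unstable≤m x with Finₚ.all? (λ i → lookup x (i ↑ˡ m) ≟ false)
  ... | yes L≡0 = hamming≤ʳ m x (veto x) λ i → decidable-stable (_ ≟ _) λ x≢fx →
    contradiction (trans (sym (L≡0 i)) (unstable⇒true x _ x≢fx)) λ ()
  ... | no  L≢0 = hamming≤ˡ m x (veto x) λ j → decidable-stable (_ ≟ _) λ x≢fx →
    L≢0 λ i → unstable⇒vetoed x _ x≢fx (i ↑ˡ m) (l→r i j)

  zero-s : m ≤ s veto
  zero-s = subst (_≤ s veto) (ℕₚ.m+n∸n≡m m m) (n∸k≤s veto zero-unstable≤m)

proposition3p12 : (m : ℕ) → 1 ≤ m → (s[ K m ° ,2]≡ (2 * m ∸ 1)) × (s₊[ K m ° ,2]≡ m)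
proposition3p12 m 1≤m =
    -- `2 * m` unfolds to `m + (m + 0)`.
    subst s[ K m ° ,2]≡_ (cong (λ k → m + k ∸ 1) (sym (ℕₚ.+-identityʳ m)))
      ( (U.veto , U∈F , ℕₚ.≤-antisym (s≤n∸1 m 1≤m U.veto U∈F) (unit-s m))
      , s≤n∸1 m 1≤m )
  , (Z.veto , Z∈F₊ , ℕₚ.≤-antisym (s₊≤m m 1≤m Z.veto Z∈F₊) (zero-s m))
  , s₊≤m m 1≤m
  where
  module U = Veto (K? {m}) K-irrefl (unitPatterns m)
  module Z = Veto (K? {m}) K-irrefl (λ _ _ → false)

  U∈F = U.veto∈F (K-pred m 1≤m)

  Z∈F₊ : F₊[ K m ° ,2] Z.veto
  Z∈F₊ = Z.veto∈F (K-pred m 1≤m) , Z.veto-monotone (λ _ _ → refl)
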